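{- Let $d$ be a positive integer and $\mathcal D$ a Ferrers diagram of order $n$ such that $(\mathcal D,d)$ is irreducible. If $(i_1,\ell_1),(i_2,\ell_2)\in\mathcal D\cap\mathcal B_{n,d-1}$ with $i_1<i_2$ and $\ell_2<\ell_1$, then $(i_2,\ell_1)\in\mathcal D$.
   Context: $\mathbb N=\{1,2,\dots\}$. A Ferrers diagram is a finite $\mathcal D\subseteq\mathbb N^2$ with $(x,y)\in\mathcal D\Rightarrow(i,j)\in\mathcal D$ for all $1\le i\le x$, $1\le j\le y$ (row, column); order $n$ means $\mathcal D\subseteq\{1,\dots,n\}^2$. $\mathcal B_{n,d-1}=\{d-1,\dots,n\}\times\{d-1,\dots,n\}$. $\nu_j(\mathcal D,d)=|\{(x,y)\in\mathcal D:x\ge d-j,\ y\ge j+1\}|$ for $0\le j\le d-1$, $\nu_{\min}(\mathcal D,d)=\min_j\nu_j(\mathcal D,d)$. For $P\in\mathcal D$ such that $\mathcal D'=\mathcal D\setminus\{P\}$ is a Ferrers diagram: if $\nu_{\min}(\mathcal D',d)=\nu_{\min}(\mathcal D,d)$ write $\mathcal D'\xrightarrow{d}\mathcal D$, otherwise $\mathcal D\xrightarrow{d}\mathcal D'$. $(\mathcal D,d)$ is irreducible if there is no Ferrers diagram $\mathcal D'$ with $\mathcal D'\xrightarrow{d}\mathcal D$. -}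

module Defs where

open import Data.Nat using (ℕ; zero; suc; _+_; _∸_; _≤_; _<_; _≤ᵇ_; _≡ᵇ_; _⊓_)
open import Data.Bool using (Bool; true; false; _∧_; not; if_then_else_)
open import Data.List using (List; map; upTo)
open import Data.Nat.ListAction using (sum)
open import Data.Empty using (⊥)
open import Data.Product using (Σ; _×_; _,_)
open import Data.Sum using (_⊎_)
open import Relation.Binary.PropositionalEquality using (_≡_; _≢_)

-- A Ferrers diagram: a finite subset of ℕ² (ℕ = {1,2,...}, coordinates
-- (row, column)), given by a decidable membership predicate, together with
-- a bound witnessing finiteness, closed downward in both coordinates.
record FerrersDiagram : Set where
  field
    mem    : ℕ → ℕ → Bool
    bound  : ℕ
    inBox  : ∀ x y → mem x y ≡ true → (1 ≤ x × x ≤ bound) × (1 ≤ y × y ≤ bound)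
    closed : ∀ x y i j → mem x y ≡ true → 1 ≤ i → i ≤ x → 1 ≤ j → j ≤ y →
             mem i j ≡ true
open FerrersDiagram public

_∈D_ : ℕ × ℕ → FerrersDiagram → Set
(x , y) ∈D D = mem D x y ≡ true

OfOrder : ℕ → FerrersDiagram → Set
OfOrder n D = ∀ x y → (x , y) ∈D D → x ≤ n × y ≤ n

countCells : FerrersDiagram → (ℕ → ℕ → Bool) → ℕ
countCells D p =
  sum (map (λ x → sum (map (λ y → if mem D x y ∧ p x y then 1 else 0)
                            (upTo (suc (bound D)))))
           (upTo (suc (bound D))))

ν : FerrersDiagram → ℕ → ℕ → ℕ
ν D d j = countCells D (λ x y → ((d ∸ j) ≤ᵇ x) ∧ (suc j ≤ᵇ y))

νminUpTo : FerrersDiagram → ℕ → ℕ → ℕ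
νminUpTo D d zero    = ν D d 0
νminUpTo D d (suc k) = ν D d (suc k) ⊓ νminUpTo D d k

-- ν_min(D,d) = min_{0 ≤ j ≤ d-1} ν_j(D,d)   (only used for d ≥ 1)
νmin : FerrersDiagram → ℕ → ℕ
νmin D d = νminUpTo D d (d ∸ 1)

IsRemoval : FerrersDiagram → FerrersDiagram → ℕ × ℕ → Set
IsRemoval D D' (p , q) =
  (p , q) ∈D D ×
  (∀ x y → mem D' x y ≡ (mem D x y ∧ not ((x ≡ᵇ p) ∧ (y ≡ᵇ q))))

-- E →_d F
-- For P ∈ D with D' = D \ {P} Ferrers: if ν_min(D',d) = ν_min(D,d) then
-- D' →_d D, otherwise D →_d D'.
Arrow : ℕ → FerrersDiagram → FerrersDiagram → Set
Arrow d E F =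
  (Σ (ℕ × ℕ) λ P → IsRemoval F E P × νmin E d ≡ νmin F d)
  ⊎ (Σ (ℕ × ℕ) λ P → IsRemoval E F P × νmin F d ≢ νmin E d)

Irreducible : FerrersDiagram → ℕ → Set
Irreducible D d = ∀ (D' : FerrersDiagram) → Arrow d D' D → ⊥

InB : ℕ → ℕ → ℕ × ℕ → Set
InB n d (x , y) = (d ∸ 1 ≤ x × x ≤ n) × (d ∸ 1 ≤ y × y ≤ n)

-- If (i₂, ℓ₁) were missing, D would have an addable corner Q = (x, y) with
-- x > i₁ ≥ d - 1 and y > ℓ₂ ≥ d - 1: walk along row i₂ from ℓ₂ to the last
-- cell before column ℓ₁, then down the next column from row i₁ to the last
-- cell before row i₂.  Such a Q lies in the region counted by every ν_j, so
-- adding it raises every ν_j, hence ν_min, by one; thus D ∪ {Q} →_d D,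
-- contradicting irreducibility.
module Submission where

open import Defs
open import Data.Nat using (ℕ; zero; suc; _+_; _∸_; _≤_; _<_; _≤ᵇ_; _≡ᵇ_; _⊓_; z≤n; s≤s)
open import Data.Nat.Properties
open import Data.Bool using (Bool; true; false; _∧_; _∨_; not; if_then_else_)
open import Data.Bool.Properties using (∨-identityʳ; ∨-zeroʳ; ∧-identityʳ; ∧-zeroʳ; T-≡; T-∧)
open import Data.List using (map; upTo; _++_; [_])
open import Data.List.Properties using (upTo-∷ʳ; map-++)
open import Data.Nat.ListAction using (sum)
open import Data.Nat.ListAction.Properties using (sum-++)
open import Data.Product using (_×_; _,_; proj₁; proj₂; ∃-syntax)
open import Data.Sum using (inj₂)
open import Data.Empty using (⊥; ⊥-elim)
open import Function.Bundles using (Equivalence)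
open import Relation.Nullary using (Dec; yes; no)
open import Function using (_∘_)
open import Relation.Binary.PropositionalEquality hiding ([_])

open Equivalence using (to; from)

sum-upTo-suc : ∀ (f : ℕ → ℕ) n →
               sum (map f (upTo (suc n))) ≡ sum (map f (upTo n)) + f n
sum-upTo-suc f n = begin
  sum (map f (upTo (suc n)))        ≡⟨ cong (λ l → sum (map f l)) (sym (upTo-∷ʳ n)) ⟩
  sum (map f (upTo n ++ [ n ]))     ≡⟨ cong sum (map-++ f (upTo n) [ n ]) ⟩
  sum (map f (upTo n) ++ [ f n ])   ≡⟨ sum-++ (map f (upTo n)) [ f n ] ⟩
  sum (map f (upTo n)) + (f n + 0)  ≡⟨ cong (sum (map f (upTo n)) +_) (+-identityʳ (f n)) ⟩
  sum (map f (upTo n)) + f n        ∎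
  where open ≡-Reasoning

sum-upTo-cong : ∀ {f g : ℕ → ℕ} n → (∀ k → k < n → g k ≡ f k) →
                sum (map g (upTo n)) ≡ sum (map f (upTo n))
sum-upTo-cong zero    _  = refl
sum-upTo-cong {f} {g} (suc n) g≡f = begin
  sum (map g (upTo (suc n)))  ≡⟨ sum-upTo-suc g n ⟩
  sum (map g (upTo n)) + g n  ≡⟨ cong₂ _+_ (sum-upTo-cong n (λ k k<n → g≡f k (m<n⇒m<1+n k<n)))
                                           (g≡f n ≤-refl) ⟩
  sum (map f (upTo n)) + f n  ≡⟨ sum-upTo-suc f n ⟨
  sum (map f (upTo (suc n)))  ∎
  where open ≡-Reasoning

sum-upTo-incr-at : ∀ {f g : ℕ → ℕ} {x} n → x < n →
                   (∀ k → k ≢ x → g k ≡ f k) → g x ≡ suc (f x) →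
                   sum (map g (upTo n)) ≡ suc (sum (map f (upTo n)))
sum-upTo-incr-at {f} {g} {x} (suc n) x<1+n g≡f gx≡1+fx = begin
  sum (map g (upTo (suc n)))       ≡⟨ sum-upTo-suc g n ⟩
  sum (map g (upTo n)) + g n       ≡⟨ lastOrEarlier (x ≟ n) ⟩
  suc (sum (map f (upTo n)) + f n) ≡⟨ cong suc (sum-upTo-suc f n) ⟨
  suc (sum (map f (upTo (suc n)))) ∎
  where
  open ≡-Reasoning
  lastOrEarlier : Dec (x ≡ n) →
                  sum (map g (upTo n)) + g n ≡ suc (sum (map f (upTo n)) + f n)
  lastOrEarlier (yes refl) =
    trans (cong₂ _+_ (sum-upTo-cong x (λ k k<x → g≡f k (<⇒≢ k<x))) gx≡1+fx)
          (+-suc _ (f x))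
  lastOrEarlier (no x≢n) =
    cong₂ _+_ (sum-upTo-incr-at n (≤∧≢⇒< (≤-pred x<1+n) x≢n) g≡f gx≡1+fx)
              (g≡f n (x≢n ∘ sym))

true→false-step : (g : ℕ → Bool) {a b : ℕ} → g a ≡ true → g b ≡ false → a < b →
                  ∃[ z ] a ≤ z × suc z ≤ b × g z ≡ true × g (suc z) ≡ false
true→false-step g {a} {suc b} ga gb a<1+b with g b in gb′
... | true  = b , ≤-pred a<1+b , ≤-refl , gb′ , gb
... | false with a ≟ b
...   | yes refl with () ← trans (sym ga) gb′
...   | no a≢b with true→false-step g ga gb′ (≤∧≢⇒< (≤-pred a<1+b) a≢b)
...     | z , a≤z , 1+z≤b , gz , g1+z = z , a≤z , m≤n⇒m≤1+n 1+z≤b , gz , g1+z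

≡ᵇ-refl : ∀ u → (u ≡ᵇ u) ≡ true
≡ᵇ-refl u = to T-≡ (≡⇒≡ᵇ u u refl)

νminUpTo-suc : ∀ {E F : FerrersDiagram} d k → (∀ j → j ≤ k → ν E d j ≡ suc (ν F d j)) →
               νminUpTo E d k ≡ suc (νminUpTo F d k)
νminUpTo-suc d zero    ν≡ = ν≡ 0 z≤n
νminUpTo-suc d (suc k) ν≡ =
  cong₂ _⊓_ (ν≡ (suc k) ≤-refl) (νminUpTo-suc d k (λ j j≤k → ν≡ j (m≤n⇒m≤1+n j≤k)))

record AddableCell (D : FerrersDiagram) (x y : ℕ) : Set where
  field
    1≤x     : 1 ≤ x
    1≤y     : 1 ≤ y
    x≤bound : x ≤ bound D
    y≤bound : y ≤ bound D
    absent  : mem D x y ≡ false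
    above   : ∀ i j → 1 ≤ i → i < x → 1 ≤ j → j ≤ y → (i , j) ∈D D
    leftOf  : ∀ i j → 1 ≤ i → i ≤ x → 1 ≤ j → j < y → (i , j) ∈D D

module Insert {D : FerrersDiagram} {x y : ℕ} (Q : AddableCell D x y) where
  open AddableCell Q

  isQ : ℕ → ℕ → Bool
  isQ u v = (u ≡ᵇ x) ∧ (v ≡ᵇ y)

  isQ≡true⇒ : ∀ u v → isQ u v ≡ true → u ≡ x × v ≡ y
  isQ≡true⇒ u v h with to T-∧ (from T-≡ h)
  ... | u≡ᵇx , v≡ᵇy = ≡ᵇ⇒≡ u x u≡ᵇx , ≡ᵇ⇒≡ v y v≡ᵇy

  isQ-Q : isQ x y ≡ true
  isQ-Q rewrite ≡ᵇ-refl x | ≡ᵇ-refl y = refl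

  isQ-other : ∀ {u v} → (u , v) ≢ (x , y) → isQ u v ≡ false
  isQ-other {u} {v} ne with isQ u v in eq
  ... | false = refl
  ... | true with refl , refl ← isQ≡true⇒ u v eq = ⊥-elim (ne refl)

  mem⁺ : ℕ → ℕ → Bool
  mem⁺ u v = mem D u v ∨ isQ u v

  mem⁺-old : ∀ {u v} → mem D u v ≡ true → mem⁺ u v ≡ true
  mem⁺-old h rewrite h = refl

  mem⁺-Q : mem⁺ x y ≡ true
  mem⁺-Q rewrite isQ-Q = ∨-zeroʳ (mem D x y)

  inBox⁺ : ∀ u v → mem⁺ u v ≡ true → (1 ≤ u × u ≤ bound D) × (1 ≤ v × v ≤ bound D)
  inBox⁺ u v h with mem D u v in eq
  ... | true = inBox D u v eq
  ... | false with refl , refl ← isQ≡true⇒ u v h = (1≤x , x≤bound) , (1≤y , y≤bound)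

  closed⁺ : ∀ u v i j → mem⁺ u v ≡ true → 1 ≤ i → i ≤ u → 1 ≤ j → j ≤ v →
            mem⁺ i j ≡ true
  closed⁺ u v i j h 1≤i i≤u 1≤j j≤v with mem D u v in eq
  ... | true = mem⁺-old (closed D u v i j eq 1≤i i≤u 1≤j j≤v)
  ... | false with refl , refl ← isQ≡true⇒ u v h with i <? x | j <? y
  ...   | yes i<x | _       = mem⁺-old (above i j 1≤i i<x 1≤j j≤v)
  ...   | no _    | yes j<y = mem⁺-old (leftOf i j 1≤i i≤u 1≤j j<y)
  ...   | no i≮x  | no j≮y
          with refl ← ≤-antisym i≤u (≮⇒≥ i≮x) | refl ← ≤-antisym j≤v (≮⇒≥ j≮y) = mem⁺-Q

  D⁺ : FerrersDiagram
  D⁺ = record { mem = mem⁺ ; bound = bound D ; inBox = inBox⁺ ; closed = closed⁺ }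

  D⁺-removal : IsRemoval D⁺ D (x , y)
  D⁺-removal = mem⁺-Q , removesQ
    where
    removesQ : ∀ u v → mem D u v ≡ (mem⁺ u v ∧ not (isQ u v))
    removesQ u v with isQ u v in eq
    ... | false = sym (trans (∧-identityʳ _) (∨-identityʳ _))
    ... | true with refl , refl ← isQ≡true⇒ u v eq = trans absent (sym (∧-zeroʳ _))

  module _ (p : ℕ → ℕ → Bool) (pQ : p x y ≡ true) where
    cell : FerrersDiagram → ℕ → ℕ → ℕ
    cell E u v = if mem E u v ∧ p u v then 1 else 0

    cell⁺-other : ∀ u v → (u , v) ≢ (x , y) → cell D⁺ u v ≡ cell D u v
    cell⁺-other u v ne with mem D u v
    ... | true  = refl
    ... | false rewrite isQ-other ne = refl

    cell⁺-Q : cell D⁺ x y ≡ suc (cell D x y)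
    cell⁺-Q rewrite absent | isQ-Q | pQ = refl

    rowCount : FerrersDiagram → ℕ → ℕ
    rowCount E u = sum (map (cell E u) (upTo (suc (bound D))))

    rowCount⁺-other : ∀ u → u ≢ x → rowCount D⁺ u ≡ rowCount D u
    rowCount⁺-other u u≢x =
      sum-upTo-cong (suc (bound D)) (λ v _ → cell⁺-other u v (u≢x ∘ cong proj₁))

    rowCount⁺-Q : rowCount D⁺ x ≡ suc (rowCount D x)
    rowCount⁺-Q = sum-upTo-incr-at (suc (bound D)) (s≤s y≤bound)
                    (λ v v≢y → cell⁺-other x v (v≢y ∘ cong proj₂)) cell⁺-Q

    countCells-D⁺ : countCells D⁺ p ≡ suc (countCells D p)
    countCells-D⁺ =
      sum-upTo-incr-at (suc (bound D)) (s≤s x≤bound) rowCount⁺-other rowCount⁺-Q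

  ν-D⁺ : ∀ d j → d ∸ j ≤ x → j < y → ν D⁺ d j ≡ suc (ν D d j)
  ν-D⁺ d j d∸j≤x j<y =
    countCells-D⁺ _ (to T-≡ (from T-∧ (≤⇒≤ᵇ d∸j≤x , ≤⇒≤ᵇ j<y)))

irreducible⇒no-addable-cell-beyond : ∀ {D d x y} → Irreducible D d → AddableCell D x y →
                                     d ∸ 1 < x → d ∸ 1 < y → ⊥
irreducible⇒no-addable-cell-beyond {D} {d} {x} {y} irr Q d∸1<x d∸1<y =
  irr D⁺ (inj₂ ((x , y) , D⁺-removal , νmin-differs))
  where
  open Insert Q
  d≤x : d ≤ x
  d≤x = ≤-trans (m≤n+m∸n d 1) d∸1<x
  νmin-D⁺ : νmin D⁺ d ≡ suc (νmin D d)
  νmin-D⁺ = νminUpTo-suc d (d ∸ 1) λ j j≤d∸1 →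
    ν-D⁺ d j (≤-trans (m∸n≤m d j) d≤x) (≤-<-trans j≤d∸1 d∸1<y)
  νmin-differs : νmin D d ≢ νmin D⁺ d
  νmin-differs eq = <⇒≢ (n<1+n _) (trans eq νmin-D⁺)

addable-cell-between : ∀ {D i₁ ℓ₁ i₂ ℓ₂} → (i₁ , ℓ₁) ∈D D → (i₂ , ℓ₂) ∈D D →
                       i₁ < i₂ → ℓ₂ < ℓ₁ → mem D i₂ ℓ₁ ≡ false →
                       ∃[ x ] ∃[ y ] i₁ < x × ℓ₂ < y × AddableCell D x y
addable-cell-between {D} {i₁} {ℓ₁} {i₂} {ℓ₂} P₁∈D P₂∈D i₁<i₂ ℓ₂<ℓ₁ P∉D
  with y , ℓ₂≤y , 1+y≤ℓ₁ , i₂y∈D , i₂1+y∉D ← true→false-step (mem D i₂) P₂∈D P∉D ℓ₂<ℓ₁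
  with x , i₁≤x , 1+x≤i₂ , x1+y∈D , Q∉D
       ← true→false-step (λ u → mem D u (suc y))
           (closed D i₁ ℓ₁ i₁ (suc y) P₁∈D (proj₁ (proj₁ (inBox D i₁ ℓ₁ P₁∈D))) ≤-refl
                   (s≤s z≤n) 1+y≤ℓ₁)
           i₂1+y∉D i₁<i₂
  = suc x , suc y , s≤s i₁≤x , s≤s ℓ₂≤y , record
      { 1≤x     = s≤s z≤n
      ; 1≤y     = s≤s z≤n
      ; x≤bound = ≤-trans 1+x≤i₂ (proj₂ (proj₁ (inBox D i₂ ℓ₂ P₂∈D)))
      ; y≤bound = ≤-trans 1+y≤ℓ₁ (proj₂ (proj₂ (inBox D i₁ ℓ₁ P₁∈D)))
      ; absent  = Q∉D
      ; above   = λ i j 1≤i i<1+x 1≤j j≤1+y →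
                    closed D x (suc y) i j x1+y∈D 1≤i (≤-pred i<1+x) 1≤j j≤1+y
      ; leftOf  = λ i j 1≤i i≤1+x 1≤j j<1+y →
                    closed D i₂ y i j i₂y∈D 1≤i (≤-trans i≤1+x 1+x≤i₂) 1≤j (≤-pred j<1+y)
      }

lemma4p6 : (n d : ℕ) (D : FerrersDiagram) → 1 ≤ d → OfOrder n D →
    Irreducible D d →
    (i₁ ℓ₁ i₂ ℓ₂ : ℕ) →
    (i₁ , ℓ₁) ∈D D → InB n d (i₁ , ℓ₁) →
    (i₂ , ℓ₂) ∈D D → InB n d (i₂ , ℓ₂) →
    i₁ < i₂ → ℓ₂ < ℓ₁ →
    (i₂ , ℓ₁) ∈D D
lemma4p6 n d D _ _ irr i₁ ℓ₁ i₂ ℓ₂ P₁∈D P₁∈B P₂∈D P₂∈B i₁<i₂ ℓ₂<ℓ₁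
  with mem D i₂ ℓ₁ in i₂ℓ₁
... | true  = refl
... | false
  with x , y , i₁<x , ℓ₂<y , Q ← addable-cell-between P₁∈D P₂∈D i₁<i₂ ℓ₂<ℓ₁ i₂ℓ₁
  = ⊥-elim (irreducible⇒no-addable-cell-beyond {D} {d} irr Q
              (≤-<-trans (proj₁ (proj₁ P₁∈B)) i₁<x)
              (≤-<-trans (proj₁ (proj₂ P₂∈B)) ℓ₂<y))
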